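{- For every integer $n \ge 1$ with binary representation $n = \sum_{i \ge 0} b_i 2^i$, $b_i \in \{0,1\}$, let $R(n) = \sum_{i \ge 0} b_i n^i$. Then $R(n) \equiv m(n-1) \pmod 2$ for all $n \ge 1$.
   Context: For a non-negative integer $k$, $s_2(k)$ denotes the number of ones in the binary expansion of $k$. Define $\bar{t}(k) = 1$ if $s_2(k)$ is even and $\bar{t}(k)=0$ if $s_2(k)$ is odd. The sequence $m(n)$, $n \ge 0$, is defined by $m(2k) = \bar{t}(k)$ and $m(2k+1) = 0$ for all $k \ge 0$. The sequence $R(n)$ is OEIS A104258 (replace $2^i$ with $n^i$ in the binary representation of $n$), indexed from $n=1$: $1,2,4,16,26,42,57,512,\ldots$. -}

module Defs where

open import Data.Bool.Base using (if_then_else_)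
open import Data.Digit using (Expansion; 1b; toDigits)
open import Data.Fin.Base using (toℕ)
open import Data.Fin.Properties using (_≟_)
open import Data.List.Base using ([]; _∷_; filter; length; lookup; map; tabulate)
open import Data.Nat.Base using (ℕ; _+_; _*_; _^_; _/_)
open import Data.Nat.Divisibility using (_∣_; _∣?_; m∣m*n; ∣1⇒≡1; ∣m+n∣m⇒∣n)
open import Data.Nat.DivMod using (m*n/n≡m)
open import Data.Nat.ListAction using (sum)
open import Data.Nat.Properties using (*-comm)
open import Data.Product.Base using (proj₁)
open import Relation.Binary.PropositionalEquality using (_≡_; refl; cong; trans)
open import Relation.Nullary.Decidable using (does; dec-true; dec-false)
open import Relation.Nullary using (¬_)

-- Least significant bit first, so that position i carries the weight 2 ^ i.
bits : ℕ → Expansion 2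
bits n = proj₁ (toDigits 2 n)

s₂ : ℕ → ℕ
s₂ k = length (filter (_≟ 1b) (bits k))

t̄ : ℕ → ℕ
t̄ k = if does (2 ∣? s₂ k) then 1 else 0

m : ℕ → ℕ
m n = if does (2 ∣? n) then t̄ (n / 2) else 0

-- Σᵢ bᵢ nⁱ, where the bᵢ are the bits of n; the sum stops at the length of
-- the expansion, beyond which every bᵢ is 0.
R : ℕ → ℕ
R n = sum (tabulate (λ i → toℕ (lookup (bits n) i) * n ^ toℕ i))

-- The two equations that characterise m.

m-even : ∀ k → m (2 * k) ≡ t̄ k
m-even k = trans
  (cong (if_then t̄ (2 * k / 2) else 0) (dec-true (2 ∣? (2 * k)) (m∣m*n k)))
  (cong t̄ (trans (cong (_/ 2) (*-comm 2 k)) (m*n/n≡m k 2)))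

m-odd : ∀ k → m (2 * k + 1) ≡ 0
m-odd k = cong (if_then t̄ ((2 * k + 1) / 2) else 0) (dec-false (2 ∣? (2 * k + 1)) 2∤)
  where
  2∤ : ¬ (2 ∣ 2 * k + 1)
  2∤ 2∣ with () ← ∣1⇒≡1 (∣m+n∣m⇒∣n 2∣ (m∣m*n k))

-- The initial terms of OEIS A104258.
R-initial : map R (1 ∷ 2 ∷ 3 ∷ 4 ∷ 5 ∷ 6 ∷ 7 ∷ 8 ∷ []) ≡
            1 ∷ 2 ∷ 4 ∷ 16 ∷ 26 ∷ 42 ∷ 57 ∷ 512 ∷ []
R-initial = refl

{-# OPTIONS --safe #-}

-- Modulo 2, every n ^ i with i ≥ 1 is congruent to n, so R n is congruent to
-- b₀ + n · s₂ ⌊n / 2⌋, where b₀ ≡ n is the last bit of n.  This is 0 for even n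
-- and 1 + s₂ k ≡ t̄ k for n = 2 k + 1.
module Submission where

open import Defs
open import Data.Bool.Base using (if_then_else_)
open import Data.Digit using (Expansion; 1b; fromDigits; toDigits)
open import Data.Fin.Base using (toℕ; zero; suc)
open import Data.Fin.Properties using (_≟_)
open import Data.List.Base using ([]; _∷_; filter; length; lookup; tabulate)
open import Data.Nat.Base using (ℕ; zero; suc; _+_; _*_; _^_; _≤_; _∸_; _%_; parity)
open import Data.Nat.Divisibility using (_∣?_)
open import Data.Nat.ListAction using (sum)
open import Data.Nat.Properties
  using (+-comm; +-identityʳ; *-comm; *-identityʳ; *-cancelʳ-≡; suc-injective; even≢odd)
import Data.Parity.Base as ℙ
open import Data.Parity.Base using (0ℙ; 1ℙ)
open import Data.Parity.Properties as ℙ using (+-homo-+; *-homo-*)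
open import Data.Product.Base using (proj₂)
open import Relation.Binary.PropositionalEquality
  using (_≡_; _≢_; refl; sym; trans; cong; cong₂; module ≡-Reasoning)
open import Relation.Nullary using (contradiction)
open import Relation.Nullary.Decidable using (does)

open ≡-Reasoning

-- The computation takes place in the two-element field of parities, where multiplication is
-- idempotent. There all powers of `n` with positive exponent coincide, so the bits above the last
-- one contribute the parity of `n` times their number of ones (`parity-weightedSum`). The last bit,
-- of weight `n ^ 0`, is split off, and its value decides between the two cases of `m`
-- (`parity-weightedSum-^`). Since `t̄` flips the parity of `s₂` (`parity-t̄`), the extra 1 from an
-- odd `n` matches.

parity-≡⇒%2-≡ : ∀ m n → parity m ≡ parity n → m % 2 ≡ n % 2
parity-≡⇒%2-≡ (suc (suc m)) n             eq = parity-≡⇒%2-≡ m n eq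
parity-≡⇒%2-≡ zero          (suc (suc n)) eq = parity-≡⇒%2-≡ zero n eq
parity-≡⇒%2-≡ (suc zero)    (suc (suc n)) eq = parity-≡⇒%2-≡ (suc zero) n eq
parity-≡⇒%2-≡ zero          zero          eq = refl
parity-≡⇒%2-≡ (suc zero)    (suc zero)    eq = refl

-- The exponent is positive because `n ^ 0` is odd even when `n` is even.
parity-^ : ∀ n i → parity (n ^ suc i) ≡ parity n
parity-^ n zero    = cong parity (*-identityʳ n)
parity-^ n (suc i) = begin
  parity (n * n ^ suc i)             ≡⟨ *-homo-* n (n ^ suc i) ⟩
  parity n ℙ.* parity (n ^ suc i)    ≡⟨ cong (parity n ℙ.*_) (parity-^ n i) ⟩
  parity n ℙ.* parity n              ≡⟨ ℙ.*-idem (parity n) ⟩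
  parity n                           ∎

parity-*2 : ∀ n → parity (n * 2) ≡ 0ℙ
parity-*2 zero    = refl
parity-*2 (suc n) = parity-*2 n

ones : Expansion 2 → ℕ
ones ds = length (filter (_≟ 1b) ds)

weightedSum : (ℕ → ℕ) → Expansion 2 → ℕ
weightedSum w ds = sum (tabulate (λ i → toℕ (lookup ds i) * w (toℕ i)))

-- The weights are arbitrary so that the induction can shift them by one position when it drops the
-- first digit; each digit 1 then adds one `p`.
parity-weightedSum : ∀ {p} w → (∀ i → parity (w i) ≡ p) → ∀ ds →
                     parity (weightedSum w ds) ≡ p ℙ.* parity (ones ds)
parity-weightedSum {p} w w≡p []              = sym (ℙ.*-zeroʳ p)
parity-weightedSum     w w≡p (zero ∷ ds)     =
  parity-weightedSum (λ i → w (suc i)) (λ i → w≡p (suc i)) ds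
parity-weightedSum {p} w w≡p (suc zero ∷ ds) = begin
  parity (w 0 + 0 + S)                     ≡⟨ +-homo-+ (w 0 + 0) S ⟩
  parity (w 0 + 0) ℙ.+ parity S            ≡⟨ cong₂ ℙ._+_ w₀≡p S≡ ⟩
  p ℙ.+ (p ℙ.* parity (ones ds))           ≡⟨ cong (ℙ._+ (p ℙ.* parity (ones ds))) (ℙ.*-identityʳ p) ⟨
  (p ℙ.* 1ℙ) ℙ.+ (p ℙ.* parity (ones ds))  ≡⟨ ℙ.*-distribˡ-+ p 1ℙ (parity (ones ds)) ⟨
  p ℙ.* (1ℙ ℙ.+ parity (ones ds))          ≡⟨ cong (p ℙ.*_) (+-homo-+ 1 (ones ds)) ⟨
  p ℙ.* parity (suc (ones ds))             ∎
  where
  S    = weightedSum (λ i → w (suc i)) ds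
  S≡   = parity-weightedSum (λ i → w (suc i)) (λ i → w≡p (suc i)) ds
  w₀≡p = trans (cong parity (+-identityʳ (w 0))) (w≡p 0)

*2≢1+*2 : ∀ k l → k * 2 ≢ suc (l * 2)
*2≢1+*2 k l eq = even≢odd k l (trans (*-comm 2 k) (trans eq (cong suc (*-comm l 2))))

-- Expansions of the same number may differ in leading zeros.
ones-unique : ∀ ds es → fromDigits ds ≡ fromDigits es → ones ds ≡ ones es
ones-unique []              []              eq = refl
ones-unique []              (zero ∷ es)     eq =
  ones-unique [] es (*-cancelʳ-≡ 0 (fromDigits es) 2 eq)
ones-unique (zero ∷ ds)     []              eq =
  ones-unique ds [] (*-cancelʳ-≡ (fromDigits ds) 0 2 eq)
ones-unique (zero ∷ ds)     (zero ∷ es)     eq =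
  ones-unique ds es (*-cancelʳ-≡ (fromDigits ds) (fromDigits es) 2 eq)
ones-unique (zero ∷ ds)     (suc zero ∷ es) eq =
  contradiction eq (*2≢1+*2 (fromDigits ds) (fromDigits es))
ones-unique (suc zero ∷ ds) (zero ∷ es)     eq =
  contradiction (sym eq) (*2≢1+*2 (fromDigits es) (fromDigits ds))
ones-unique (suc zero ∷ ds) (suc zero ∷ es) eq =
  cong suc (ones-unique ds es (*-cancelʳ-≡ (fromDigits ds) (fromDigits es) 2 (suc-injective eq)))

-- Needed because the tail of an expansion of `n` represents half of `n`, rounded down, but is not
-- known to be literally the list that `bits` returns for it.
s₂-fromDigits : ∀ ds → s₂ (fromDigits ds) ≡ ones ds
s₂-fromDigits ds = ones-unique (bits (fromDigits ds)) ds (proj₂ (toDigits 2 (fromDigits ds)))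

parity-t̄ : ∀ k → parity (t̄ k) ≡ parity (suc (s₂ k))
parity-t̄ k = go (s₂ k)
  where
  go : ∀ s → parity (if does (2 ∣? s) then 1 else 0) ≡ parity (suc s)
  go zero          = refl
  go (suc zero)    = refl
  -- Both sides have period 2 in `s` by computation.
  go (suc (suc s)) = go s

-- Stating this for any expansion `ds` of `n`, instead of `bits n`, allows a case split on the last
-- bit.
parity-weightedSum-^ : ∀ ds n → fromDigits ds ≡ n → 1 ≤ n →
                       parity (weightedSum (n ^_) ds) ≡ parity (m (n ∸ 1))
parity-weightedSum-^ [] _ refl ()
-- Here `n` is twice the value of the tail, which is positive; writing that value as `suc k` makes
-- `n ∸ 1` the odd number `suc (k * 2)`.
parity-weightedSum-^ (zero ∷ ds) n eq 1≤n with fromDigits ds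
parity-weightedSum-^ (zero ∷ ds) _ refl () | zero
parity-weightedSum-^ (zero ∷ ds) n refl _  | suc k = begin
  parity (weightedSum (λ i → n ^ suc i) ds)
    ≡⟨ parity-weightedSum (λ i → n ^ suc i) (λ i → trans (parity-^ n i) (parity-*2 k)) ds ⟩
  0ℙ
    ≡⟨ cong parity (m-odd k) ⟨
  parity (m (2 * k + 1))
    ≡⟨ cong (λ j → parity (m j)) (trans (+-comm (2 * k) 1) (cong suc (*-comm 2 k))) ⟩
  parity (m (suc (k * 2)))
    ∎
parity-weightedSum-^ (suc zero ∷ ds) n refl _ = begin
  -- The `suc` is the last bit's contribution `n ^ 0`, and `n ∸ 1` is `k * 2`.
  parity (suc S)                ≡⟨ +-homo-+ 1 S ⟩
  1ℙ ℙ.+ parity S               ≡⟨ cong (1ℙ ℙ.+_) (parity-weightedSum (λ i → n ^ suc i) odd-powers ds) ⟩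
  1ℙ ℙ.+ parity (ones ds)       ≡⟨ +-homo-+ 1 (ones ds) ⟨
  parity (suc (ones ds))        ≡⟨ cong (λ s → parity (suc s)) (s₂-fromDigits ds) ⟨
  parity (suc (s₂ k))           ≡⟨ parity-t̄ k ⟨
  parity (t̄ k)                  ≡⟨ cong parity (m-even k) ⟨
  parity (m (2 * k))            ≡⟨ cong (λ j → parity (m j)) (*-comm 2 k) ⟩
  parity (m (k * 2))            ∎
  where
  k = fromDigits ds
  S = weightedSum (λ i → n ^ suc i) ds

  odd-powers : ∀ i → parity (n ^ suc i) ≡ 1ℙ
  odd-powers i = trans (parity-^ n i)
    (trans (+-homo-+ 1 (k * 2)) (cong (1ℙ ℙ.+_) (parity-*2 k)))

lemma7 : (n : ℕ) → 1 ≤ n → R n % 2 ≡ m (n ∸ 1) % 2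
lemma7 n 1≤n = parity-≡⇒%2-≡ (R n) (m (n ∸ 1))
  (parity-weightedSum-^ (bits n) n (proj₂ (toDigits 2 n)) 1≤n)
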